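{- Let $r \ge 3$ be an integer. Then there exists $m_0$ such that for every integer $m \ge m_0$, at least one of the pairs $\left(m, \left\lfloor \binom{m}{r}/2 \right\rfloor\right)$ and $\left(m, \left\lfloor \binom{m}{r}/2 \right\rfloor - m - 1\right)$ is absolutely $r$-avoidable.
   Context: An $r$-graph is an $r$-uniform hypergraph. For an $r$-graph $G$ and a pair of non-negative integers $(m,f)$, write $G \to_r (m,f)$ if $G$ has an induced sub-hypergraph on $m$ vertices with exactly $f$ hyperedges. For pairs of non-negative integers, write $(n,e) \to_r (m,f)$ if every $r$-graph with $n$ vertices and $e$ hyperedges satisfies $G \to_r (m,f)$. A pair $(m,f)$ with $m \ge 1$ and $0 \le f \le \binom{m}{r}$ is called absolutely $r$-avoidable if there is $n_0$ such that for every $n > n_0$ and every integer $e$ with $0 \le e \le \binom{n}{r}$, we have $(n,e) \not\to_r (m,f)$, i.e. there exists an $r$-graph on $n$ vertices with $e$ hyperedges having no induced sub-hypergraph on $m$ vertices with $f$ hyperedges. -}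

module Defs where

open import Data.Nat using (ℕ; zero; suc; _+_; _≤_; _<_; _≡ᵇ_)
open import Data.Nat.Combinatorics using (_C_)
open import Data.Bool using (Bool; true; false; _∧_; if_then_else_)
open import Data.Fin.Subset using (Subset; inside; outside; ∣_∣)
open import Data.Vec using (Vec; []; _∷_)
open import Data.List using (List; [_]; map; _++_)
open import Data.Product using (Σ; _×_; ∃-syntax)
open import Relation.Nullary using (¬_)
open import Relation.Binary.PropositionalEquality using (_≡_)

allSubsets : (n : ℕ) → List (Subset n)
allSubsets zero = [ [] ]
allSubsets (suc n) = map (inside ∷_) (allSubsets n) ++ map (outside ∷_) (allSubsets n)

_⊆ᵇ_ : ∀ {n} → Subset n → Subset n → Bool
[] ⊆ᵇ [] = true
(true ∷ S) ⊆ᵇ (true ∷ U) = S ⊆ᵇ U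
(true ∷ S) ⊆ᵇ (false ∷ U) = false
(false ∷ S) ⊆ᵇ (_ ∷ U) = S ⊆ᵇ U

count : ∀ {A : Set} → (A → Bool) → List A → ℕ
count p Data.List.[] = 0
count p (x Data.List.∷ xs) = (if p x then 1 else 0) + count p xs

-- An r-graph on vertex set Fin n: a predicate deciding which subsets are
-- hyperedges; only subsets of size exactly r are counted as hyperedges.
Hypergraph : ℕ → Set
Hypergraph n = Subset n → Bool

isEdge : ∀ {n} (r : ℕ) → Hypergraph n → Subset n → Bool
isEdge r H S = (∣ S ∣ ≡ᵇ r) ∧ H S

numEdges : ∀ {n} (r : ℕ) → Hypergraph n → ℕ
numEdges {n} r H = count (isEdge r H) (allSubsets n)

inducedEdges : ∀ {n} (r : ℕ) → Hypergraph n → Subset n → ℕ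
inducedEdges {n} r H U = count (λ S → (S ⊆ᵇ U) ∧ isEdge r H S) (allSubsets n)

Arrows : ∀ {n} (r : ℕ) → Hypergraph n → ℕ → ℕ → Set
Arrows {n} r H m f = ∃[ U ] (∣ U ∣ ≡ m × inducedEdges r H U ≡ f)

NotArrowsPair : (r n e m f : ℕ) → Set
NotArrowsPair r n e m f = ∃[ H ] (numEdges {n} r H ≡ e × ¬ Arrows r H m f)

AbsolutelyAvoidable : (r m f : ℕ) → Set
AbsolutelyAvoidable r m f =
  1 ≤ m × f ≤ m C r ×
  ∃[ n₀ ] (∀ n → n₀ < n → ∀ e → e ≤ n C r → NotArrowsPair r n e m f)

{-# OPTIONS --safe #-}

-- Write N = C(m, r). Given e ≤ C(n, r) / 2, take the largest clique with at
-- most e edges and add the missing M ≤ C(n, r - 1) edges one at a time so that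
-- no m-set gains more than m of them. This is possible by a potential argument:
-- for λ = 1 + μ a small multiple of n, the sum over the m-sets U of
-- λ ^ (edges gained by U) starts at C(n, m) and, choosing each new edge below
-- average, at most doubles, so it stays below λ ^ (m + 1).
-- The m-sets then span C(x, r) + s edges with x, s ≤ m. Passing to complements
-- for e > C(n, r) / 2, a pair (m, f) is avoidable once neither f nor N - f lies
-- in an interval [C(x, r), C(x, r) + m]. For f = N / 2 this fails only if some
-- C(x, r) lies in a window of length about m around N / 2; as the gaps between
-- consecutive C(x, r) there exceed 2 m + 2 (this needs r ≥ 3), both
-- f = N / 2 - m - 1 and its complement then fall between the intervals.
module Submission where

open import Defs
open import Data.Nat using (ℕ; _≤_; _∸_; _/_)
open import Data.Nat.Combinatorics using (_C_)
open import Data.Sum using (_⊎_)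
open import Data.Product using (∃-syntax)

open import Data.Bool using (Bool; true; false; _∧_; _∨_; not; if_then_else_; T)
import Data.Bool.Properties as Bool
open import Data.Fin.Subset using (Subset; ∣_∣; _∩_; ⊤; ⊥)
open import Data.Fin.Subset.Properties using (∣⊤∣≡n; ∣⊥∣≡0; ∣p∩q∣≤∣p∣)
open import Data.List using (List; []; _∷_; map)
open import Data.List.Properties using (map-++; map-∘; map-cong)
open import Data.Nat using (zero; suc; _+_; _*_; _^_; _%_; _<_; z≤n; s≤s; s≤s⁻¹; _≡ᵇ_; NonZero; >-nonZero)
open import Data.Nat.Combinatorics using (nCk+nC[k+1]≡[n+1]C[k+1]; nC1≡n; k>n⇒nCk≡0)
open import Data.Nat.DivMod using (m/n*n≤m; m*n/n≡m; /-monoˡ-≤; m≡m%n+[m/n]*n; m%n<n; m/n≤m)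
open import Data.Nat.ListAction using (sum)
open import Data.Nat.ListAction.Properties using (sum-++)
open import Data.Nat.Properties
open import Data.Nat.Tactic.RingSolver using (solve-∀)
open import Data.Product using (_×_; _,_; proj₁; proj₂)
open import Data.Sum using (inj₁; inj₂)
open import Data.Vec using ([]; _∷_)
open import Data.Vec.Properties using (≡-dec)
open import Relation.Binary.PropositionalEquality
open import Relation.Nullary using (¬_; Dec; does; yes; no; contradiction; _×-dec_)

private variable
  A : Set
  n : ℕ

-- Finite sums and counts over lists.

⟦_⟧ : Bool → ℕ
⟦ b ⟧ = if b then 1 else 0

⟦b⟧≤1 : ∀ b → ⟦ b ⟧ ≤ 1
⟦b⟧≤1 true  = ≤-refl
⟦b⟧≤1 false = z≤n

∑ : List A → (A → ℕ) → ℕ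
∑ xs f = sum (map f xs)

module _ {A : Set} where

  ∑-cong : ∀ (xs : List A) {f g : A → ℕ} → (∀ x → f x ≡ g x) → ∑ xs f ≡ ∑ xs g
  ∑-cong xs f≗g = cong sum (map-cong f≗g xs)

  ∑-mono : ∀ (xs : List A) {f g : A → ℕ} → (∀ x → f x ≤ g x) → ∑ xs f ≤ ∑ xs g
  ∑-mono []       f≤g = z≤n
  ∑-mono (x ∷ xs) f≤g = +-mono-≤ (f≤g x) (∑-mono xs f≤g)

  ∑-+ : ∀ (xs : List A) (f g : A → ℕ) → ∑ xs (λ x → f x + g x) ≡ ∑ xs f + ∑ xs g
  ∑-+ []       f g = refl
  ∑-+ (x ∷ xs) f g rewrite ∑-+ xs f g = interchange (f x) (g x) (∑ xs f) (∑ xs g)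
    where
    interchange : ∀ a b c d → a + b + (c + d) ≡ a + c + (b + d)
    interchange = solve-∀

  ∑-*ˡ : ∀ c (xs : List A) (f : A → ℕ) → ∑ xs (λ x → c * f x) ≡ c * ∑ xs f
  ∑-*ˡ c []       f = sym (*-zeroʳ c)
  ∑-*ˡ c (x ∷ xs) f rewrite ∑-*ˡ c xs f = sym (*-distribˡ-+ c (f x) (∑ xs f))

  ∑-0 : ∀ (xs : List A) → ∑ xs (λ _ → 0) ≡ 0
  ∑-0 []       = refl
  ∑-0 (x ∷ xs) = ∑-0 xs

  count≡∑ : ∀ (p : A → Bool) xs → count p xs ≡ ∑ xs (λ x → ⟦ p x ⟧)
  count≡∑ p []       = refl
  count≡∑ p (x ∷ xs) = cong (⟦ p x ⟧ +_) (count≡∑ p xs)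

  count-cong : ∀ {p q : A → Bool} → (∀ x → p x ≡ q x) → ∀ xs → count p xs ≡ count q xs
  count-cong p≗q []       = refl
  count-cong p≗q (x ∷ xs) = cong₂ (λ b c → ⟦ b ⟧ + c) (p≗q x) (count-cong p≗q xs)

  count-split : ∀ (p q : A → Bool) xs →
    count (λ x → p x ∧ q x) xs + count (λ x → p x ∧ not (q x)) xs ≡ count p xs
  count-split p q []       = refl
  count-split p q (x ∷ xs) with p x | q x
  ... | false | _     = count-split p q xs
  ... | true  | true  = cong suc (count-split p q xs)
  ... | true  | false = trans (+-suc _ _) (cong suc (count-split p q xs))

  -- Averaging without division: of the head and the candidate found in the tail, the recursion
  -- keeps the one with the smaller value of `f`.
  ∑-below-average : ∀ (p : A → Bool) (f : A → ℕ) xs → 1 ≤ count p xs →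
    ∃[ x ] (p x ≡ true × count p xs * f x ≤ ∑ xs (λ y → ⟦ p y ⟧ * f y))
  ∑-below-average p f (x ∷ xs) 1≤c with p x in px
  ... | false = ∑-below-average p f xs 1≤c
  ... | true  with count p xs in c | ∑-below-average p f xs
  ...   | zero  | _  = x , px , ≤-trans (≤-reflexive (+-identityʳ (f x)))
                                  (≤-trans (≤-reflexive (sym (+-identityʳ (f x)))) (m≤m+n (f x + 0) _))
  ...   | suc k | IH with IH (s≤s z≤n)
  ...     | y , py , avg with ≤-total (f x) (f y)
  ...       | inj₁ fx≤fy = x , px , +-mono-≤ (m≤m+n (f x) 0) (≤-trans (*-monoʳ-≤ (suc k) fx≤fy) avg)
  ...       | inj₂ fy≤fx = y , py , +-mono-≤ (≤-trans fy≤fx (m≤m+n (f x) 0)) avg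

∑-swap : ∀ {A B : Set} (xs : List A) (ys : List B) (f : A → B → ℕ) →
  ∑ xs (λ x → ∑ ys (f x)) ≡ ∑ ys (λ y → ∑ xs (λ x → f x y))
∑-swap []       ys f = sym (∑-0 ys)
∑-swap (x ∷ xs) ys f =
  trans (cong (∑ ys (f x) +_) (∑-swap xs ys f)) (sym (∑-+ ys (f x) (λ y → ∑ xs (λ x → f x y))))

-- Counting subsets of a given size.

∑-allSubsets : ∀ n (f : Subset (suc n) → ℕ) →
  ∑ (allSubsets (suc n)) f ≡ ∑ (allSubsets n) (λ S → f (true ∷ S)) + ∑ (allSubsets n) (λ S → f (false ∷ S))
∑-allSubsets n f
  rewrite map-++ f (map (true ∷_) (allSubsets n)) (map (false ∷_) (allSubsets n))
        | sum-++ (map f (map (true ∷_) (allSubsets n))) (map f (map (false ∷_) (allSubsets n)))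
        | sym (map-∘ {g = f} {f = true ∷_} (allSubsets n))
        | sym (map-∘ {g = f} {f = false ∷_} (allSubsets n)) = refl

count-allSubsets : ∀ n (p : Subset (suc n) → Bool) →
  count p (allSubsets (suc n))
    ≡ count (λ S → p (true ∷ S)) (allSubsets n) + count (λ S → p (false ∷ S)) (allSubsets n)
count-allSubsets n p
  rewrite count≡∑ p (allSubsets (suc n))
        | count≡∑ (λ S → p (true ∷ S)) (allSubsets n)
        | count≡∑ (λ S → p (false ∷ S)) (allSubsets n) = ∑-allSubsets n (λ S → ⟦ p S ⟧)

count-false : ∀ {p : A → Bool} → (∀ x → p x ≡ false) → ∀ xs → count p xs ≡ 0
count-false p≗false []       = refl
count-false p≗false (x ∷ xs) rewrite p≗false x = count-false p≗false xs

-- If the first vertex lies in `U`, splitting the subsets by whether they contain it gives Pascal's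
-- rule; otherwise only subsets omitting it count.
count-⊆-size : ∀ r (U : Subset n) → count (λ S → (S ⊆ᵇ U) ∧ (∣ S ∣ ≡ᵇ r)) (allSubsets n) ≡ ∣ U ∣ C r
count-⊆-size zero    [] = refl
count-⊆-size (suc r) [] = refl
count-⊆-size {suc n} r (false ∷ U)
  rewrite count-allSubsets n (λ S → (S ⊆ᵇ (false ∷ U)) ∧ (∣ S ∣ ≡ᵇ r))
        | count-false {p = λ (S : Subset n) → false} (λ _ → refl) (allSubsets n) = count-⊆-size r U
count-⊆-size {suc n} zero (true ∷ U)
  rewrite count-allSubsets n (λ S → (S ⊆ᵇ (true ∷ U)) ∧ (∣ S ∣ ≡ᵇ zero))
        | count-false {p = λ (S : Subset n) → (S ⊆ᵇ U) ∧ false} (λ S → Bool.∧-zeroʳ (S ⊆ᵇ U)) (allSubsets n)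
        = count-⊆-size zero U
count-⊆-size {suc n} (suc r) (true ∷ U)
  rewrite count-allSubsets n (λ S → (S ⊆ᵇ (true ∷ U)) ∧ (∣ S ∣ ≡ᵇ suc r))
        | count-⊆-size r U | count-⊆-size (suc r) U = nCk+nC[k+1]≡[n+1]C[k+1] ∣ U ∣ r

⊆ᵇ-⊤ : (S : Subset n) → (S ⊆ᵇ ⊤) ≡ true
⊆ᵇ-⊤ []          = refl
⊆ᵇ-⊤ (true  ∷ S) = ⊆ᵇ-⊤ S
⊆ᵇ-⊤ (false ∷ S) = ⊆ᵇ-⊤ S

⊆ᵇ-∩ : (S U V : Subset n) → (S ⊆ᵇ (U ∩ V)) ≡ (S ⊆ᵇ U) ∧ (S ⊆ᵇ V)
⊆ᵇ-∩ []          []          []          = refl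
⊆ᵇ-∩ (true  ∷ S) (true  ∷ U) (true  ∷ V) = ⊆ᵇ-∩ S U V
⊆ᵇ-∩ (true  ∷ S) (true  ∷ U) (false ∷ V) = sym (Bool.∧-zeroʳ (S ⊆ᵇ U))
⊆ᵇ-∩ (true  ∷ S) (false ∷ U) (_     ∷ V) = refl
⊆ᵇ-∩ (false ∷ S) (_     ∷ U) (_     ∷ V) = ⊆ᵇ-∩ S U V

count-size : ∀ n r → count (λ (S : Subset n) → ∣ S ∣ ≡ᵇ r) (allSubsets n) ≡ n C r
count-size n r = begin
  count (λ S → ∣ S ∣ ≡ᵇ r) (allSubsets n)
    ≡⟨ count-cong (λ S → cong (_∧ (∣ S ∣ ≡ᵇ r)) (⊆ᵇ-⊤ S)) (allSubsets n) ⟨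
  count (λ S → (S ⊆ᵇ ⊤) ∧ (∣ S ∣ ≡ᵇ r)) (allSubsets n)
    ≡⟨ count-⊆-size r (⊤ {n}) ⟩
  ∣ ⊤ {n} ∣ C r
    ≡⟨ cong (_C r) (∣⊤∣≡n n) ⟩
  n C r ∎
  where open ≡-Reasoning

-- Adding a single edge.

_≟ˢ_ : (S U : Subset n) → Dec (S ≡ U)
_≟ˢ_ = ≡-dec Bool._≟_

-- Each subset occurs exactly once in `allSubsets n`, so a point mass at `S` selects one term.
∑-δ : ∀ (S : Subset n) (w : Subset n → ℕ) → ∑ (allSubsets n) (λ X → ⟦ does (X ≟ˢ S) ⟧ * w X) ≡ w S
∑-δ []          w = trans (+-identityʳ _) (+-identityʳ _)
∑-δ {suc n} (true ∷ S) w
  rewrite ∑-allSubsets n (λ X → ⟦ does (X ≟ˢ (true ∷ S)) ⟧ * w X)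
        | ∑-0 (allSubsets n) = trans (+-identityʳ _) (∑-δ S (λ X → w (true ∷ X)))
∑-δ {suc n} (false ∷ S) w
  rewrite ∑-allSubsets n (λ X → ⟦ does (X ≟ˢ (false ∷ S)) ⟧ * w X)
        | ∑-0 (allSubsets n) = ∑-δ S (λ X → w (false ∷ X))

term≤∑ : ∀ (w : Subset n → ℕ) S → w S ≤ ∑ (allSubsets n) w
term≤∑ {n} w S = ≤-trans (≤-reflexive (sym (∑-δ S w)))
  (∑-mono (allSubsets n) (λ X → ≤-trans (*-monoˡ-≤ (w X) (⟦b⟧≤1 (does (X ≟ˢ S)))) (≤-reflexive (*-identityˡ (w X)))))

insert : Subset n → Hypergraph n → Hypergraph n
insert S H X = does (X ≟ˢ S) ∨ H X

-- As `S` is new, the indicator of `insert S H` is that of `H` plus a point mass at `S`. The filter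
-- `p` is general so as to serve both `numEdges` and `inducedEdges`.
count-insert : ∀ (p : Subset n → Bool) {H : Hypergraph n} {S} → H S ≡ false →
  count (λ X → p X ∧ insert S H X) (allSubsets n) ≡ ⟦ p S ⟧ + count (λ X → p X ∧ H X) (allSubsets n)
count-insert {n} p {H} {S} S∉H = begin
  count (λ X → p X ∧ insert S H X) (allSubsets n)
    ≡⟨ count≡∑ _ (allSubsets n) ⟩
  ∑ (allSubsets n) (λ X → ⟦ p X ∧ insert S H X ⟧)
    ≡⟨ ∑-cong (allSubsets n) split ⟩
  ∑ (allSubsets n) (λ X → ⟦ does (X ≟ˢ S) ⟧ * ⟦ p X ⟧ + ⟦ p X ∧ H X ⟧)
    ≡⟨ ∑-+ (allSubsets n) _ _ ⟩
  ∑ (allSubsets n) (λ X → ⟦ does (X ≟ˢ S) ⟧ * ⟦ p X ⟧) + ∑ (allSubsets n) (λ X → ⟦ p X ∧ H X ⟧)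
    ≡⟨ cong₂ _+_ (∑-δ S (λ X → ⟦ p X ⟧)) (sym (count≡∑ _ (allSubsets n))) ⟩
  ⟦ p S ⟧ + count (λ X → p X ∧ H X) (allSubsets n) ∎
  where
  open ≡-Reasoning
  split : ∀ X → ⟦ p X ∧ insert S H X ⟧ ≡ ⟦ does (X ≟ˢ S) ⟧ * ⟦ p X ⟧ + ⟦ p X ∧ H X ⟧
  split X with X ≟ˢ S
  ... | no  _    = refl
  ... | yes refl rewrite S∉H | Bool.∧-zeroʳ (p X) | Bool.∧-identityʳ (p X) =
    sym (trans (+-identityʳ _) (+-identityʳ _))

numEdges-insert : ∀ {r} {H : Hypergraph n} {S} → (∣ S ∣ ≡ᵇ r) ≡ true → H S ≡ false →
  numEdges r (insert S H) ≡ suc (numEdges r H)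
numEdges-insert {r = r} {H} {S} |S|≡r S∉H =
  trans (count-insert (λ X → ∣ X ∣ ≡ᵇ r) {H} {S} S∉H) (cong (λ b → ⟦ b ⟧ + numEdges r H) |S|≡r)

inducedEdges≡count : ∀ r (H : Hypergraph n) U →
  inducedEdges r H U ≡ count (λ X → ((X ⊆ᵇ U) ∧ (∣ X ∣ ≡ᵇ r)) ∧ H X) (allSubsets n)
inducedEdges≡count {n} r H U =
  count-cong (λ X → sym (Bool.∧-assoc (X ⊆ᵇ U) (∣ X ∣ ≡ᵇ r) (H X))) (allSubsets n)

inducedEdges-insert : ∀ {r} {H : Hypergraph n} {S} → (∣ S ∣ ≡ᵇ r) ≡ true → H S ≡ false →
  ∀ U → inducedEdges r (insert S H) U ≡ ⟦ S ⊆ᵇ U ⟧ + inducedEdges r H U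
inducedEdges-insert {r = r} {H} {S} |S|≡r S∉H U
  rewrite inducedEdges≡count r (insert S H) U | inducedEdges≡count r H U
        | count-insert (λ X → (X ⊆ᵇ U) ∧ (∣ X ∣ ≡ᵇ r)) {H} {S} S∉H
        | |S|≡r | Bool.∧-identityʳ (S ⊆ᵇ U) = refl

-- Complements and cliques.

numEdges-complement : ∀ r (H : Hypergraph n) → numEdges r H + numEdges r (λ X → not (H X)) ≡ n C r
numEdges-complement {n} r H =
  trans (count-split (λ X → ∣ X ∣ ≡ᵇ r) H (allSubsets n)) (count-size n r)

inducedEdges-complement : ∀ r (H : Hypergraph n) U →
  inducedEdges r H U + inducedEdges r (λ X → not (H X)) U ≡ ∣ U ∣ C r
inducedEdges-complement {n} r H U
  rewrite inducedEdges≡count r H U | inducedEdges≡count r (λ X → not (H X)) U =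
  trans (count-split (λ X → (X ⊆ᵇ U) ∧ (∣ X ∣ ≡ᵇ r)) H (allSubsets n)) (count-⊆-size r U)

clique : Subset n → Hypergraph n
clique A X = X ⊆ᵇ A

numEdges-clique : ∀ r (A : Subset n) → numEdges r (clique A) ≡ ∣ A ∣ C r
numEdges-clique {n} r A =
  trans (count-cong (λ X → Bool.∧-comm (∣ X ∣ ≡ᵇ r) (X ⊆ᵇ A)) (allSubsets n)) (count-⊆-size r A)

inducedEdges-clique : ∀ r (A U : Subset n) → inducedEdges r (clique A) U ≡ ∣ U ∩ A ∣ C r
inducedEdges-clique {n} r A U = trans (count-cong regroup (allSubsets n)) (count-⊆-size r (U ∩ A))
  where
  regroup : ∀ X → (X ⊆ᵇ U) ∧ ((∣ X ∣ ≡ᵇ r) ∧ (X ⊆ᵇ A)) ≡ (X ⊆ᵇ (U ∩ A)) ∧ (∣ X ∣ ≡ᵇ r)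
  regroup X rewrite ⊆ᵇ-∩ X U A | Bool.∧-comm (∣ X ∣ ≡ᵇ r) (X ⊆ᵇ A) = sym (Bool.∧-assoc (X ⊆ᵇ U) _ _)

≡ᵇ-true⇒≡ : ∀ {a b} → (a ≡ᵇ b) ≡ true → a ≡ b
≡ᵇ-true⇒≡ {a} {b} a≡ᵇb = ≡ᵇ⇒≡ a b (subst T (sym a≡ᵇb) _)

≡ᵇ-refl : ∀ a → (a ≡ᵇ a) ≡ true
≡ᵇ-refl zero    = refl
≡ᵇ-refl (suc a) = ≡ᵇ-refl a

∧-true : ∀ {a b} → a ∧ b ≡ true → a ≡ true × b ≡ true
∧-true {true} {true} _ = refl , refl

not-true : ∀ {a} → not a ≡ true → a ≡ false
not-true {false} _ = refl

-- The potential argument for adding edges evenly.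

module Greedy (n r m D μ : ℕ) .{{_ : NonZero (m C r)}} (base : Subset n → ℕ) where

  K : ℕ
  K = m C r

  -- The exponent counts the edges gained over `base`, later taken to be the counts in the starting
  -- hypergraph; the indicator discards sets of size other than `m`.
  weight : Hypergraph n → Subset n → ℕ
  weight H U = ⟦ ∣ U ∣ ≡ᵇ m ⟧ * suc μ ^ (inducedEdges r H U ∸ base U)

  Φ : Hypergraph n → ℕ
  Φ H = ∑ (allSubsets n) (weight H)

  -- The share of `Φ H` carried by sets containing `S`, the only ones affected when `S` becomes an
  -- edge.
  Ψ : Hypergraph n → Subset n → ℕ
  Ψ H S = ∑ (allSubsets n) (λ U → ⟦ S ⊆ᵇ U ⟧ * weight H U)

  nonedge : Hypergraph n → Subset n → Bool
  nonedge H S = (∣ S ∣ ≡ᵇ r) ∧ not (H S)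

  -- Double counting: an `m`-set contains `K` sets of size `r`, so its weight is counted at most `K`
  -- times; sets of other sizes have weight zero.
  ∑Ψ≤KΦ : ∀ H → ∑ (allSubsets n) (λ S → ⟦ nonedge H S ⟧ * Ψ H S) ≤ K * Φ H
  ∑Ψ≤KΦ H = begin
    ∑ (allSubsets n) (λ S → ⟦ nonedge H S ⟧ * Ψ H S)
      ≡⟨ ∑-cong (allSubsets n) (λ S → sym (∑-*ˡ ⟦ nonedge H S ⟧ (allSubsets n) _)) ⟩
    ∑ (allSubsets n) (λ S → ∑ (allSubsets n) (λ U → ⟦ nonedge H S ⟧ * (⟦ S ⊆ᵇ U ⟧ * weight H U)))
      ≡⟨ ∑-swap (allSubsets n) (allSubsets n) _ ⟩
    ∑ (allSubsets n) (λ U → ∑ (allSubsets n) (λ S → ⟦ nonedge H S ⟧ * (⟦ S ⊆ᵇ U ⟧ * weight H U)))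
      ≤⟨ ∑-mono (allSubsets n) (λ U → ∑-mono (allSubsets n) (drop-not U)) ⟩
    ∑ (allSubsets n) (λ U → ∑ (allSubsets n) (λ S → weight H U * ⟦ (S ⊆ᵇ U) ∧ (∣ S ∣ ≡ᵇ r) ⟧))
      ≡⟨ ∑-cong (allSubsets n) edges-within ⟩
    ∑ (allSubsets n) (λ U → K * weight H U)
      ≡⟨ ∑-*ˡ K (allSubsets n) (weight H) ⟩
    K * Φ H ∎
    where
    open ≤-Reasoning
    drop-not : ∀ U S → ⟦ nonedge H S ⟧ * (⟦ S ⊆ᵇ U ⟧ * weight H U)
                         ≤ weight H U * ⟦ (S ⊆ᵇ U) ∧ (∣ S ∣ ≡ᵇ r) ⟧
    drop-not U S with S ⊆ᵇ U | ∣ S ∣ ≡ᵇ r | H S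
    ... | false | b     | c     = ≤-trans (≤-reflexive (*-zeroʳ ⟦ b ∧ not c ⟧)) z≤n
    ... | true  | false | _     = z≤n
    ... | true  | true  | true  = z≤n
    ... | true  | true  | false = ≤-reflexive (unit (weight H U))
      where
      unit : ∀ a → 1 * (1 * a) ≡ a * 1
      unit = solve-∀
    edges-within : ∀ U → ∑ (allSubsets n) (λ S → weight H U * ⟦ (S ⊆ᵇ U) ∧ (∣ S ∣ ≡ᵇ r) ⟧) ≡ K * weight H U
    edges-within U
      rewrite ∑-*ˡ (weight H U) (allSubsets n) (λ S → ⟦ (S ⊆ᵇ U) ∧ (∣ S ∣ ≡ᵇ r) ⟧)
            | sym (count≡∑ (λ S → (S ⊆ᵇ U) ∧ (∣ S ∣ ≡ᵇ r)) (allSubsets n))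
            | count-⊆-size r U with ∣ U ∣ ≡ᵇ m in |U|≡m
    ... | true  = trans (*-comm (1 * suc μ ^ (inducedEdges r H U ∸ base U)) (∣ U ∣ C r))
                        (cong (λ u → (u C r) * (1 * suc μ ^ (inducedEdges r H U ∸ base U))) (≡ᵇ-true⇒≡ |U|≡m))
    ... | false = sym (*-zeroʳ K)

  -- Some non-edge carries at most its average share of `K * Φ H`. The number of non-edges is
  -- assumed large enough that adding this one raises `Φ` by at most one `D`-th.
  light-nonedge : ∀ H → 1 ≤ count (nonedge H) (allSubsets n) → D * μ * K ≤ count (nonedge H) (allSubsets n) →
    ∃[ S ] (nonedge H S ≡ true × D * (μ * Ψ H S) ≤ Φ H)
  light-nonedge H 1≤N DμK≤N with ∑-below-average (nonedge H) (Ψ H) (allSubsets n) 1≤N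
  ... | S , S∉H , avg = S , S∉H , *-cancelˡ-≤ K (begin
    K * (D * (μ * Ψ H S))                      ≡⟨ regroup K D μ (Ψ H S) ⟩
    D * μ * K * Ψ H S                          ≤⟨ *-monoˡ-≤ (Ψ H S) DμK≤N ⟩
    count (nonedge H) (allSubsets n) * Ψ H S   ≤⟨ avg ⟩
    ∑ (allSubsets n) (λ S → ⟦ nonedge H S ⟧ * Ψ H S) ≤⟨ ∑Ψ≤KΦ H ⟩
    K * Φ H                                    ∎)
    where
    open ≤-Reasoning
    regroup : ∀ a b c d → a * (b * (c * d)) ≡ b * c * a * d
    regroup = solve-∀

  -- Only sets containing `S` gain an edge, and that multiplies their weight by at most `suc μ`.
  Φ-insert : ∀ H {S} → (∣ S ∣ ≡ᵇ r) ≡ true → H S ≡ false → Φ (insert S H) ≤ Φ H + μ * Ψ H S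
  Φ-insert H {S} |S|≡r S∉H = begin
    Φ (insert S H)
      ≤⟨ ∑-mono (allSubsets n) step ⟩
    ∑ (allSubsets n) (λ U → weight H U + μ * (⟦ S ⊆ᵇ U ⟧ * weight H U))
      ≡⟨ ∑-+ (allSubsets n) (weight H) _ ⟩
    Φ H + ∑ (allSubsets n) (λ U → μ * (⟦ S ⊆ᵇ U ⟧ * weight H U))
      ≡⟨ cong (Φ H +_) (∑-*ˡ μ (allSubsets n) _) ⟩
    Φ H + μ * Ψ H S ∎
    where
    open ≤-Reasoning
    step : ∀ U → weight (insert S H) U ≤ weight H U + μ * (⟦ S ⊆ᵇ U ⟧ * weight H U)
    step U rewrite inducedEdges-insert {r = r} {H} {S} |S|≡r S∉H U with S ⊆ᵇ U
    ... | false = m≤m+n _ _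
    -- With truncated subtraction the exponent grows by at most one, which is all that is needed.
    ... | true  = ≤-trans
      (*-monoʳ-≤ ⟦ ∣ U ∣ ≡ᵇ m ⟧ (^-monoʳ-≤ (suc μ) {suc a ∸ b} {suc (a ∸ b)} (m+n∸o≤m+[n∸o] 1 a b)))
      (≤-reflexive (expand ⟦ ∣ U ∣ ≡ᵇ m ⟧ μ (suc μ ^ (a ∸ b))))
      where
      a = inducedEdges r H U
      b = base U
      m+n∸o≤m+[n∸o] : ∀ m n o → m + n ∸ o ≤ m + (n ∸ o)
      m+n∸o≤m+[n∸o] m n zero          = ≤-refl
      m+n∸o≤m+[n∸o] m zero    (suc o) = m∸n≤m (m + 0) (suc o)
      m+n∸o≤m+[n∸o] m (suc n) (suc o) rewrite +-suc m n = m+n∸o≤m+[n∸o] m n o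
      expand : ∀ i μ p → i * (suc μ * p) ≡ i * p + μ * (1 * (i * p))
      expand = solve-∀

  -- Each step multiplies Φ by at most 1 + 1 / D, hence by at most
  -- (t + 1 + j) / (t + j) as long as t + j ≤ D, and these factors telescope.
  extend : ∀ j t H → t + j ≤ D → D * μ * K + (j + numEdges r H) ≤ n C r →
    ∃[ H′ ] (numEdges r H′ ≡ j + numEdges r H
             × (∀ U → inducedEdges r H U ≤ inducedEdges r H′ U)
             × suc t * Φ H′ ≤ suc (t + j) * Φ H)
  extend zero    t H _ _ = H , refl , (λ _ → ≤-refl) , ≤-reflexive (cong (λ u → suc u * Φ H) (sym (+-identityʳ t)))
  extend (suc j) t H t+j≤D room = H′ , |H′| , H⊆H′ , ΦH′
    where
    N = count (nonedge H) (allSubsets n)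
    -- The reserve of `D * μ * K` non-edges survives all remaining insertions, so every step finds a
    -- light one.
    room′ : D * μ * K + suc j ≤ N
    room′ = +-cancelʳ-≤ (numEdges r H) _ _ (begin
      D * μ * K + suc j + numEdges r H   ≡⟨ +-assoc (D * μ * K) (suc j) _ ⟩
      D * μ * K + (suc j + numEdges r H) ≤⟨ room ⟩
      n C r                              ≡⟨ numEdges-complement r H ⟨
      numEdges r H + N                   ≡⟨ +-comm (numEdges r H) N ⟩
      N + numEdges r H                   ∎)
      where open ≤-Reasoning
    light = light-nonedge H (≤-trans (≤-trans (s≤s z≤n) (m≤n+m (suc j) (D * μ * K))) room′)
                            (≤-trans (m≤m+n _ (suc j)) room′)
    S = proj₁ light
    |S|≡r = proj₁ (∧-true (proj₁ (proj₂ light)))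
    S∉H = not-true (proj₂ (∧-true {∣ S ∣ ≡ᵇ r} (proj₁ (proj₂ light))))
    |H₁| : numEdges r (insert S H) ≡ suc (numEdges r H)
    |H₁| = numEdges-insert {H = H} {S} |S|≡r S∉H
    next : j + numEdges r (insert S H) ≡ suc j + numEdges r H
    next = trans (cong (j +_) |H₁|) (+-suc j _)
    rest = extend j t (insert S H) (≤-trans (+-monoʳ-≤ t (n≤1+n j)) t+j≤D)
             (≤-trans (≤-reflexive (cong (D * μ * K +_) next)) room)
    H′ = proj₁ rest
    |H′| : numEdges r H′ ≡ suc j + numEdges r H
    |H′| = trans (proj₁ (proj₂ rest)) next
    H⊆H′ : ∀ U → inducedEdges r H U ≤ inducedEdges r H′ U
    H⊆H′ U = ≤-trans (≤-trans (m≤n+m _ ⟦ S ⊆ᵇ U ⟧) (≤-reflexive (sym (inducedEdges-insert {H = H} {S} |S|≡r S∉H U))))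
                     (proj₁ (proj₂ (proj₂ rest)) U)
    ΦH′ : suc t * Φ H′ ≤ suc (t + suc j) * Φ H
    ΦH′ = begin
      suc t * Φ H′                              ≤⟨ proj₂ (proj₂ (proj₂ rest)) ⟩
      suc (t + j) * Φ (insert S H)              ≡⟨ cong (_* Φ (insert S H)) (+-suc t j) ⟨
      (t + suc j) * Φ (insert S H)              ≤⟨ *-monoʳ-≤ (t + suc j) (Φ-insert H {S} |S|≡r S∉H) ⟩
      (t + suc j) * (Φ H + μ * Ψ H S)           ≡⟨ *-distribˡ-+ (t + suc j) (Φ H) _ ⟩
      (t + suc j) * Φ H + (t + suc j) * (μ * Ψ H S) ≤⟨ +-monoʳ-≤ ((t + suc j) * Φ H) (*-monoˡ-≤ _ t+j≤D) ⟩
      (t + suc j) * Φ H + D * (μ * Ψ H S)       ≤⟨ +-monoʳ-≤ ((t + suc j) * Φ H) (proj₂ (proj₂ light)) ⟩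
      (t + suc j) * Φ H + Φ H                   ≡⟨ +-comm _ (Φ H) ⟩
      suc (t + suc j) * Φ H                     ∎
      where open ≤-Reasoning

-- With `t = M` and `D = M + M` the telescoped factor `suc (M + M) / suc M` is below 2. An `m`-set
-- gaining more than `m` edges would alone weigh at least `suc μ ^ suc m`, more than the whole
-- potential.
sparse-extension : ∀ {n} r m μ M (H : Hypergraph n) → .{{NonZero (m C r)}} →
  (M + M) * μ * (m C r) + (M + numEdges r H) ≤ n C r →
  2 * (n C m) < suc μ ^ suc m →
  ∃[ H′ ] (numEdges r H′ ≡ M + numEdges r H
           × (∀ U → ∣ U ∣ ≡ m → ∃[ s ] (s ≤ m × inducedEdges r H′ U ≡ inducedEdges r H U + s)))
sparse-extension {n} r m μ M H room few = H′ , |H′| , gain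
  where
  open Greedy n r m (M + M) μ (inducedEdges r H)
  result = extend M M H ≤-refl room
  H′ = proj₁ result
  |H′| = proj₁ (proj₂ result)
  ΦH : Φ H ≡ n C m
  ΦH = trans (∑-cong (allSubsets n) start) (trans (sym (count≡∑ _ (allSubsets n))) (count-size n m))
    where
    start : ∀ U → weight H U ≡ ⟦ ∣ U ∣ ≡ᵇ m ⟧
    start U rewrite n∸n≡0 (inducedEdges r H U) = *-identityʳ _
  ΦH′ : Φ H′ ≤ 2 * (n C m)
  ΦH′ = *-cancelˡ-≤ (suc M) (begin
    suc M * Φ H′             ≤⟨ proj₂ (proj₂ (proj₂ result)) ⟩
    suc (M + M) * Φ H        ≤⟨ *-monoˡ-≤ (Φ H) (s≤s (+-monoʳ-≤ M (n≤1+n M))) ⟩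
    (suc M + suc M) * Φ H    ≡⟨ double (suc M) (Φ H) ⟩
    suc M * (2 * Φ H)        ≡⟨ cong (λ φ → suc M * (2 * φ)) ΦH ⟩
    suc M * (2 * (n C m))    ∎)
    where
    open ≤-Reasoning
    double : ∀ a b → (a + a) * b ≡ a * (2 * b)
    double = solve-∀
  gain : ∀ U → ∣ U ∣ ≡ m → ∃[ s ] (s ≤ m × inducedEdges r H′ U ≡ inducedEdges r H U + s)
  gain U |U|≡m = s , s≤m , sym (m+[n∸m]≡n (proj₁ (proj₂ (proj₂ result)) U))
    where
    s = inducedEdges r H′ U ∸ inducedEdges r H U
    weightU : weight H′ U ≡ suc μ ^ s
    weightU rewrite |U|≡m | ≡ᵇ-refl m = *-identityˡ _
    s≤m : s ≤ m
    s≤m with s ≤? m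
    ... | yes s≤m = s≤m
    ... | no  s≰m = contradiction
      (≤-trans (^-monoʳ-≤ (suc μ) (≰⇒> s≰m))
        (≤-trans (≤-reflexive (sym weightU)) (≤-trans (term≤∑ (weight H′) U) ΦH′)))
      (<⇒≱ few)

-- Binomial coefficients.

pascal : ∀ n k → suc n C suc k ≡ n C k + n C suc k
pascal n k = sym (nCk+nC[k+1]≡[n+1]C[k+1] n k)

absorption : ∀ n k → suc k * (suc n C suc k) ≡ suc n * (n C k)
absorption zero    zero    = refl
absorption zero    (suc k)
  rewrite k>n⇒nCk≡0 {1} {suc (suc k)} (s≤s (s≤s z≤n)) | k>n⇒nCk≡0 {0} {suc k} (s≤s z≤n) = *-zeroʳ (suc (suc k))
absorption (suc n) zero    = trans (*-identityˡ _) (trans (nC1≡n (suc (suc n))) (sym (*-identityʳ _)))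
absorption (suc n) (suc k) = begin
  suc (suc k) * (suc (suc n) C suc (suc k))
    ≡⟨ cong (suc (suc k) *_) (pascal (suc n) (suc k)) ⟩
  suc (suc k) * (p + suc n C suc (suc k))
    ≡⟨ expand k p (suc n C suc (suc k)) ⟩
  p + (suc k * p + suc (suc k) * (suc n C suc (suc k)))
    ≡⟨ cong (p +_) (cong₂ _+_ (absorption n k) (absorption n (suc k))) ⟩
  p + (suc n * (n C k) + suc n * (n C suc k))
    ≡⟨ cong (p +_) (*-distribˡ-+ (suc n) (n C k) (n C suc k)) ⟨
  p + suc n * (n C k + n C suc k)
    ≡⟨ cong (λ q → p + suc n * q) (pascal n k) ⟨
  suc (suc n) * p ∎
  where
  open ≡-Reasoning
  p = suc n C suc k
  expand : ∀ k p q → suc (suc k) * (p + q) ≡ p + (suc k * p + suc (suc k) * q)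
  expand = solve-∀

[k+1]*nC[k+1] : ∀ n k → suc k * (n C suc k) ≡ (n ∸ k) * (n C k)
[k+1]*nC[k+1] n k = +-cancelˡ-≡ (suc k * (n C k)) _ _ (begin
  suc k * (n C k) + suc k * (n C suc k) ≡⟨ *-distribˡ-+ (suc k) (n C k) _ ⟨
  suc k * (n C k + n C suc k)           ≡⟨ cong (suc k *_) (pascal n k) ⟨
  suc k * (suc n C suc k)               ≡⟨ absorption n k ⟩
  suc n * (n C k)                       ≡⟨ split ⟩
  suc k * (n C k) + (n ∸ k) * (n C k)   ∎)
  where
  open ≡-Reasoning
  split : suc n * (n C k) ≡ suc k * (n C k) + (n ∸ k) * (n C k)
  split with k ≤? n
  ... | yes k≤n = trans (cong (λ u → suc u * (n C k)) (sym (m+[n∸m]≡n k≤n)))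
                        (*-distribʳ-+ (n C k) (suc k) (n ∸ k))
  -- Here `n C k` is zero, so the truncation of `n ∸ k` is harmless.
  ... | no  k≰n rewrite k>n⇒nCk≡0 {n} {k} (≰⇒> k≰n) | *-zeroʳ n | *-zeroʳ k | *-zeroʳ (n ∸ k) = refl

C-monoˡ-suc : ∀ n k → n C k ≤ suc n C k
C-monoˡ-suc n zero    = ≤-refl
C-monoˡ-suc n (suc k) = ≤-trans (m≤n+m _ (n C k)) (≤-reflexive (sym (pascal n k)))

C-monoˡ-≤ : ∀ k {m n} → m ≤ n → m C k ≤ n C k
C-monoˡ-≤ k {m} {n} m≤n = subst (λ u → m C k ≤ u C k) (m+[n∸m]≡n m≤n) (go (n ∸ m))
  where
  go : ∀ d → m C k ≤ (m + d) C k
  go zero    = ≤-reflexive (cong (_C k) (sym (+-identityʳ m)))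
  go (suc d) = ≤-trans (go d) (≤-trans (C-monoˡ-suc (m + d) k) (≤-reflexive (cong (_C k) (sym (+-suc m d)))))

nCk≤n^k : ∀ n k → n C k ≤ n ^ k
nCk≤n^k n       zero    = ≤-refl
nCk≤n^k zero    (suc k) = ≤-reflexive (k>n⇒nCk≡0 {0} {suc k} (s≤s z≤n))
nCk≤n^k (suc n) (suc k) = begin
  suc n C suc k       ≡⟨ pascal n k ⟩
  n C k + n C suc k   ≤⟨ +-mono-≤ (nCk≤n^k n k) (nCk≤n^k n (suc k)) ⟩
  suc n * n ^ k       ≤⟨ *-monoʳ-≤ (suc n) (^-monoˡ-≤ k (n≤1+n n)) ⟩
  suc n ^ suc k       ∎
  where open ≤-Reasoning

nCk>0 : ∀ {n k} → k ≤ n → 0 < n C k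
nCk>0 {n}     {zero}  _         = s≤s z≤n
nCk>0 {suc n} {suc k} (s≤s k≤n) = ≤-trans (nCk>0 k≤n) (≤-trans (m≤m+n _ (n C suc k)) (≤-reflexive (sym (pascal n k))))

-- A linear bound suffices: two uses of `absorption` raise it to a cubic one for `m C r`.
n∸k≤nC[k+1] : ∀ n k → n ∸ k ≤ n C suc k
n∸k≤nC[k+1] zero    zero    = z≤n
n∸k≤nC[k+1] zero    (suc k) = z≤n
n∸k≤nC[k+1] (suc n) zero    = ≤-reflexive (sym (nC1≡n (suc n)))
n∸k≤nC[k+1] (suc n) (suc k) = ≤-trans (n∸k≤nC[k+1] n k) (≤-trans (m≤m+n _ (n C suc (suc k))) (≤-reflexive (sym (pascal n (suc k)))))

-- The descent stops at the first `a` with `a C suc k < e`, or at 0. In the former case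
-- `e ≤ suc a C suc k`, and Pascal's rule bounds the remainder by `a C k`. The clique will have `a`
-- vertices, and `M` edges are left to add.
largest-binomial : ∀ k n e → e ≤ n C suc k →
  ∃[ a ] (a ≤ n × ∃[ M ] (e ≡ M + a C suc k × M ≤ n C k))
largest-binomial k zero    e e≤ = 0 , z≤n , 0 , trans (n≤0⇒n≡0 (≤-trans e≤ (≤-reflexive 0C))) (sym 0C) , z≤n
  where
  0C : 0 C suc k ≡ 0
  0C = k>n⇒nCk≡0 {0} {suc k} (s≤s z≤n)
largest-binomial k (suc n) e e≤ with e ≤? n C suc k
... | yes e≤nC with largest-binomial k n e e≤nC
...   | a , a≤n , M , e≡ , M≤ = a , m≤n⇒m≤1+n a≤n , M , e≡ , ≤-trans M≤ (C-monoˡ-suc n k)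
largest-binomial k (suc n) e e≤ | no e≰nC =
  n , n≤1+n n , e ∸ n C suc k , sym (m∸n+n≡m (<⇒≤ (≰⇒> e≰nC))) ,
  ≤-trans (m≤n+o⇒m∸n≤o e (n C suc k) (≤-trans e≤ (≤-reflexive (trans (pascal n k) (+-comm (n C k) _)))))
          (C-monoˡ-suc n k)

^-distribʳ-* : ∀ o m n → (m * n) ^ o ≡ m ^ o * n ^ o
^-distribʳ-* zero    m n = refl
^-distribʳ-* (suc o) m n = trans (cong (m * n *_) (^-distribʳ-* o m n)) (interchange m n (m ^ o) (n ^ o))
  where
  interchange : ∀ a b c d → a * b * (c * d) ≡ a * c * (b * d)
  interchange = solve-∀

-- Cliques with a sparse set of added edges.

subset-of-size : ∀ {a n} → a ≤ n → ∃[ A ] (∣_∣ {n} A ≡ a)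
subset-of-size {zero}  {n}     _         = ⊥ , ∣⊥∣≡0 n
subset-of-size {suc a} {suc n} (s≤s a≤n) with subset-of-size a≤n
... | A , |A|≡a = true ∷ A , cong suc |A|≡a

-- For an `m`-set, `x` is the number of its vertices in the clique and `s` the number of added edges
-- inside it.
Covered : (r m f : ℕ) → Set
Covered r m f = ∃[ x ] ∃[ s ] (x ≤ m × s ≤ m × f ≡ x C r + s)

CoveredWitness : (r m n e : ℕ) → Set
CoveredWitness r m n e =
  ∃[ H ] (numEdges {n} r H ≡ e × (∀ U → ∣ U ∣ ≡ m → Covered r m (inducedEdges r H U)))

-- The base λ = 1 + μ must be large enough for 2 C(n, m) < λ ^ (m + 1), and
-- small enough for the remaining non-edges to outnumber 2 M μ C(m, r).
potential-base : ∀ k m c → .{{NonZero c}} → ∃[ n₀ ] (∀ n → n₀ < n →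
  ∃[ μ ] (μ * c ≤ n ∸ k × 2 * (n C m) < suc μ ^ suc m))
-- With `b = k + c` one has `n ≤ b * suc μ`, hence `2 * (n C m) ≤ 2 * b ^ m * suc μ ^ m`. The
-- threshold forces `2 * b ^ m ≤ μ`, so one further factor `suc μ` exceeds `2 * b ^ m`.
potential-base k m c = k + 2 * b ^ m * c , λ n n₀<n → (n ∸ k) / c , m/n*n≤m (n ∸ k) c , few n n₀<n
  where
  open ≤-Reasoning
  b = k + c
  module _ n (n₀<n : k + 2 * b ^ m * c < n) where
    μ = (n ∸ k) / c
    k≤n : k ≤ n
    k≤n = ≤-trans (m≤m+n k _) (<⇒≤ n₀<n)
    2bᵐ≤μ : 2 * b ^ m ≤ μ
    2bᵐ≤μ = begin
      2 * b ^ m            ≡⟨ m*n/n≡m (2 * b ^ m) c ⟨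
      2 * b ^ m * c / c    ≤⟨ /-monoˡ-≤ c (m+n≤o⇒m≤o∸n (2 * b ^ m * c) (≤-trans (≤-reflexive (+-comm _ k)) (<⇒≤ n₀<n))) ⟩
      μ                    ∎
    n≤b*[1+μ] : n ≤ b * suc μ
    n≤b*[1+μ] = begin
      n                            ≡⟨ m+[n∸m]≡n k≤n ⟨
      k + (n ∸ k)                  ≡⟨ cong (k +_) (m≡m%n+[m/n]*n (n ∸ k) c) ⟩
      k + ((n ∸ k) % c + μ * c)    ≤⟨ +-mono-≤ (m≤m*n k (suc μ)) (+-monoˡ-≤ (μ * c) (<⇒≤ (m%n<n (n ∸ k) c))) ⟩
      k * suc μ + suc μ * c        ≡⟨ cong (k * suc μ +_) (*-comm (suc μ) c) ⟩
      k * suc μ + c * suc μ        ≡⟨ *-distribʳ-+ (suc μ) k c ⟨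
      b * suc μ                    ∎
    few : 2 * (n C m) < suc μ ^ suc m
    few = begin-strict
      2 * (n C m)               ≤⟨ *-monoʳ-≤ 2 (≤-trans (nCk≤n^k n m) (^-monoˡ-≤ m n≤b*[1+μ])) ⟩
      2 * (b * suc μ) ^ m       ≡⟨ cong (2 *_) (^-distribʳ-* m b (suc μ)) ⟩
      2 * (b ^ m * suc μ ^ m)   ≡⟨ *-assoc 2 (b ^ m) _ ⟨
      2 * b ^ m * suc μ ^ m     <⟨ *-monoˡ-< (suc μ ^ m) {{m^n≢0 (suc μ) m}} (s≤s 2bᵐ≤μ) ⟩
      suc μ * suc μ ^ m         ∎

-- The `e` edges fill at most half of the `suc k`-sets, and the reserve `(M + M) * μ * K` fits in
-- the other half. The factor `4 * suc k` is chosen for this, through `[k+1]*nC[k+1]`.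
room-for-sparse-part : ∀ k n K μ M e → μ * (4 * suc k * K) ≤ n ∸ k → M ≤ n C k → 2 * e ≤ n C suc k →
  (M + M) * μ * K + e ≤ n C suc k
room-for-sparse-part k n K μ M e μc≤ M≤ 2e≤ = *-cancelˡ-≤ 2 (begin
  2 * ((M + M) * μ * K + e)      ≡⟨ *-distribˡ-+ 2 ((M + M) * μ * K) e ⟩
  2 * ((M + M) * μ * K) + 2 * e  ≤⟨ +-mono-≤ sparse (≤-trans 2e≤ (m≤m+n _ 0)) ⟩
  2 * (n C suc k)                ∎)
  where
  open ≤-Reasoning
  regroup : ∀ s M μ K → s * (2 * ((M + M) * μ * K)) ≡ μ * (4 * s * K) * M
  regroup = solve-∀
  sparse : 2 * ((M + M) * μ * K) ≤ n C suc k
  sparse = *-cancelˡ-≤ (suc k) (begin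
    suc k * (2 * ((M + M) * μ * K))   ≡⟨ regroup (suc k) M μ K ⟩
    μ * (4 * suc k * K) * M           ≤⟨ *-mono-≤ μc≤ M≤ ⟩
    (n ∸ k) * (n C k)                 ≡⟨ [k+1]*nC[k+1] n k ⟨
    suc k * (n C suc k)               ∎)

extend-clique : ∀ {n} r m μ M (A : Subset n) → .{{NonZero (m C r)}} →
  (M + M) * μ * (m C r) + (M + ∣ A ∣ C r) ≤ n C r → 2 * (n C m) < suc μ ^ suc m →
  CoveredWitness r m n (M + ∣ A ∣ C r)
extend-clique {n} r m μ M A room few = H , |H| , covered
  where
  room′ : (M + M) * μ * (m C r) + (M + numEdges r (clique A)) ≤ n C r
  room′ = subst (λ u → (M + M) * μ * (m C r) + (M + u) ≤ n C r) (sym (numEdges-clique r A)) room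
  extension = sparse-extension r m μ M (clique A) room′ few
  H = proj₁ extension
  |H| : numEdges r H ≡ M + ∣ A ∣ C r
  |H| = trans (proj₁ (proj₂ extension)) (cong (M +_) (numEdges-clique r A))
  covered : ∀ U → ∣ U ∣ ≡ m → Covered r m (inducedEdges r H U)
  covered U |U|≡m =
    ∣ U ∩ A ∣ , proj₁ gain , ≤-trans (∣p∩q∣≤∣p∣ U A) (≤-reflexive |U|≡m) , proj₁ (proj₂ gain) ,
    trans (proj₂ (proj₂ gain)) (cong (_+ proj₁ gain) (inducedEdges-clique r A U))
    where gain = proj₂ (proj₂ extension) U |U|≡m

clique-plus-sparse : ∀ k m → suc k ≤ m →
  ∃[ n₀ ] (∀ n → n₀ < n → ∀ e → 2 * e ≤ n C suc k → CoveredWitness (suc k) m n e)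
clique-plus-sparse k m k<m = proj₁ base , build
  where
  instance
    K≢0 : NonZero (m C suc k)
    K≢0 = >-nonZero (nCk>0 k<m)
  base = potential-base k m (4 * suc k * (m C suc k)) {{m*n≢0 (4 * suc k) (m C suc k)}}
  build : ∀ n → proj₁ base < n → ∀ e → 2 * e ≤ n C suc k → CoveredWitness (suc k) m n e
  build n n₀<n e 2e≤ = assemble (proj₂ base n n₀<n) (largest-binomial k n e (≤-trans (m≤m+n e _) 2e≤))
    where
    assemble : ∃[ μ ] (μ * (4 * suc k * (m C suc k)) ≤ n ∸ k × 2 * (n C m) < suc μ ^ suc m) →
      ∃[ a ] (a ≤ n × ∃[ M ] (e ≡ M + a C suc k × M ≤ n C k)) → CoveredWitness (suc k) m n e
    assemble (μ , μc≤ , few) (a , a≤n , M , e≡ , M≤) = add-sparse (subset-of-size a≤n)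
      where
      room : (M + M) * μ * (m C suc k) + (M + a C suc k) ≤ n C suc k
      room = subst (λ u → (M + M) * μ * (m C suc k) + u ≤ n C suc k) e≡
               (room-for-sparse-part k n (m C suc k) μ M e μc≤ M≤ 2e≤)
      add-sparse : ∃[ A ] (∣_∣ {n} A ≡ a) → CoveredWitness (suc k) m n e
      add-sparse (A , refl) =
        subst (CoveredWitness (suc k) m n) (sym e≡) (extend-clique (suc k) m μ M A room few)

-- From uncovered values to avoidable pairs.

-- When `e` exceeds half of `n C r`, the witness with `n C r ∸ e` edges is complemented; an `m`-set
-- spanning `f` edges in the complement spans `m C r ∸ f` in the witness.
uncovered⇒avoidable : ∀ r m f → 1 ≤ m → f ≤ m C r →
  ∃[ n₀ ] (∀ n → n₀ < n → ∀ e → 2 * e ≤ n C r → CoveredWitness r m n e) →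
  ¬ Covered r m f → ¬ Covered r m (m C r ∸ f) → AbsolutelyAvoidable r m f
uncovered⇒avoidable r m f 1≤m f≤ (n₀ , witness) ¬cov ¬cov′ = 1≤m , f≤ , n₀ , avoid
  where
  direct : ∀ {n e} → CoveredWitness r m n e → NotArrowsPair r n e m f
  direct (H , |H|≡e , cov) = H , |H|≡e , λ (U , |U|≡m , ind≡f) → ¬cov (subst (Covered r m) ind≡f (cov U |U|≡m))

  complementary : ∀ {n e} → e ≤ n C r → CoveredWitness r m n (n C r ∸ e) → NotArrowsPair r n e m f
  complementary {n} {e} e≤ (H , |H|≡ , cov) = H̅ , |H̅|≡e , λ (U , |U|≡m , ind≡f) →
      ¬cov′ (subst (Covered r m) (ind-H U |U|≡m ind≡f) (cov U |U|≡m))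
    where
    H̅ : Hypergraph n
    H̅ X = not (H X)
    |H̅|≡e : numEdges r H̅ ≡ e
    |H̅|≡e = +-cancelˡ-≡ (numEdges r H) _ _
      (trans (numEdges-complement r H) (sym (trans (cong (_+ e) |H|≡) (m∸n+n≡m e≤))))
    ind-H : ∀ U → ∣ U ∣ ≡ m → inducedEdges r H̅ U ≡ f → inducedEdges r H U ≡ m C r ∸ f
    ind-H U |U|≡m ind≡f = trans (sym (m+n∸n≡m (inducedEdges r H U) f))
      (cong (_∸ f) (trans (cong (inducedEdges r H U +_) (sym ind≡f))
                          (trans (inducedEdges-complement r H U) (cong (_C r) |U|≡m))))

  avoid : ∀ n → n₀ < n → ∀ e → e ≤ n C r → NotArrowsPair r n e m f
  avoid n n₀<n e e≤ with ≤-total (2 * e) (n C r)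
  ... | inj₁ 2e≤ = direct (witness n n₀<n e 2e≤)
  ... | inj₂ ≤2e = complementary e≤ (witness n n₀<n (n C r ∸ e) (begin
      2 * (n C r ∸ e)              ≡⟨ *-distribˡ-∸ 2 (n C r) e ⟩
      2 * (n C r) ∸ 2 * e          ≤⟨ ∸-monoʳ-≤ (2 * (n C r)) ≤2e ⟩
      2 * (n C r) ∸ n C r          ≡⟨ m+n∸m≡n (n C r) (n C r + 0) ⟩
      n C r + 0                    ≡⟨ +-identityʳ (n C r) ⟩
      n C r                        ∎))
    where open ≤-Reasoning

-- Gaps between binomial coefficients near half of `m C r`, with `r = 3 + q`.

module _ (q p : ℕ) (large : 25 + 9 * q ≤ p) where

  private
    m = 2 + p

  -- Absorbing twice turns `r * (r - 1) * N` into `m * (m - 1) * (p C suc q)`, whose last factor is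
  -- at least `8 * r`. For `r = 2` that factor would be 1, whence the need for `r ≥ 3`.
  8m[m-1]≤[2+q]N : 8 * (1 + p) * m ≤ (2 + q) * (m C (3 + q))
  8m[m-1]≤[2+q]N = *-cancelˡ-≤ (3 + q) (begin
    (3 + q) * (8 * (1 + p) * m)                  ≡⟨ regroup (3 + q) (1 + p) m ⟩
    m * ((1 + p) * (8 * (3 + q)))                ≤⟨ *-monoʳ-≤ m (*-monoʳ-≤ (1 + p) 8r≤p∸q) ⟩
    m * ((1 + p) * (p ∸ q))                      ≤⟨ *-monoʳ-≤ m (*-monoʳ-≤ (1 + p) (n∸k≤nC[k+1] p q)) ⟩
    m * ((1 + p) * (p C suc q))                  ≡⟨ cong (m *_) (absorption p (suc q)) ⟨
    m * ((2 + q) * (suc p C (2 + q)))            ≡⟨ x∙yz≈y∙xz m (2 + q) (suc p C (2 + q)) ⟩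
    (2 + q) * (m * (suc p C (2 + q)))            ≡⟨ cong ((2 + q) *_) (absorption (suc p) (2 + q)) ⟨
    (2 + q) * ((3 + q) * (m C (3 + q)))          ≡⟨ x∙yz≈y∙xz (2 + q) (3 + q) (m C (3 + q)) ⟩
    (3 + q) * ((2 + q) * (m C (3 + q)))          ∎)
    where
    open ≤-Reasoning
    open import Algebra.Properties.CommutativeSemigroup *-commutativeSemigroup using (x∙yz≈y∙xz)
    regroup : ∀ a b c → a * (8 * b * c) ≡ c * (b * (8 * a))
    regroup = solve-∀
    -- The threshold `25 + 9 * q` is what `8 * (3 + q) ≤ p ∸ q` asks for, with one to spare.
    excess : ∀ q → 1 + (8 * (3 + q) + q) ≡ 25 + 9 * q
    excess = solve-∀
    8r≤p∸q : 8 * (3 + q) ≤ p ∸ q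
    8r≤p∸q = m+n≤o⇒m≤o∸n (8 * (3 + q)) (≤-trans (n≤1+n (8 * (3 + q) + q)) (≤-trans (≤-reflexive (excess q)) large))

  -- This places `m + 1` below `N / 2`, so that `N / 2 ∸ m ∸ 1` is not truncated.
  4[m+1]≤N : 4 * (1 + m) ≤ m C (3 + q)
  4[m+1]≤N = *-cancelˡ-≤ (2 + q) (begin
    (2 + q) * (4 * (1 + m))       ≤⟨ *-monoʳ-≤ (2 + q) (*-monoʳ-≤ 4 (+-monoˡ-≤ m {1} {m} (s≤s z≤n))) ⟩
    (2 + q) * (4 * (m + m))       ≡⟨ regroup (2 + q) m ⟩
    8 * (2 + q) * m               ≤⟨ *-monoˡ-≤ m (*-monoʳ-≤ 8 2+q≤1+p) ⟩
    8 * (1 + p) * m               ≤⟨ 8m[m-1]≤[2+q]N ⟩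
    (2 + q) * (m C (3 + q))       ∎)
    where
    open ≤-Reasoning
    regroup : ∀ a b → a * (4 * (b + b)) ≡ 8 * a * b
    regroup = solve-∀
    2+q≤1+p : 2 + q ≤ 1 + p
    2+q≤1+p = s≤s (≤-trans (+-mono-≤ (s≤s (z≤n {24})) (m≤n*m q 9)) large)

  -- By absorption `r * (suc x C r)` is `suc x` times the gap `x C (r - 1)`. A gap of at most
  -- `2 + 2 * m` would bound `r * N` by `(4 + 4 * m + 3 * r) * m`, too little beside
  -- `8 * (m - 1) * m ≤ (r - 1) * N`.
  binomial-gap : ∀ x → suc x ≤ m → m C (3 + q) ≤ 1 + 2 * (suc x C (3 + q) + m) → 2 + 2 * m < x C (2 + q)
  binomial-gap x x<m N≤ with x C (2 + q) ≤? 2 + 2 * m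
  ... | no  big   = ≰⇒> big
  ... | yes small = contradiction (begin-strict
    8 * (1 + p) * m                                      ≤⟨ 8m[m-1]≤[2+q]N ⟩
    (2 + q) * (m C (3 + q))                              <⟨ +-monoˡ-≤ ((2 + q) * (m C (3 + q))) (≤-trans (s≤s z≤n) 4[m+1]≤N) ⟩
    (3 + q) * (m C (3 + q))                              ≤⟨ *-monoʳ-≤ (3 + q) N≤ ⟩
    (3 + q) * (1 + 2 * (suc x C (3 + q) + m))            ≡⟨ distribute (3 + q) (suc x C (3 + q)) m ⟩
    2 * ((3 + q) * (suc x C (3 + q))) + (1 + 2 * m) * (3 + q)
                                                         ≡⟨ cong (λ u → 2 * u + (1 + 2 * m) * (3 + q)) (absorption x (2 + q)) ⟩
    2 * (suc x * (x C (2 + q))) + (1 + 2 * m) * (3 + q)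
      ≤⟨ +-mono-≤ (*-monoʳ-≤ 2 (*-mono-≤ x<m small)) (*-monoˡ-≤ (3 + q) (+-monoˡ-≤ (2 * m) {1} {m} (s≤s z≤n))) ⟩
    2 * (m * (2 + 2 * m)) + (m + 2 * m) * (3 + q)        ≡⟨ factor m (3 + q) ⟩
    (4 + 4 * m + 3 * (3 + q)) * m                        ≤⟨ *-monoˡ-≤ m main-term ⟩
    8 * (1 + p) * m                                      ∎) (<-irrefl refl)
    where
    open ≤-Reasoning
    distribute : ∀ r b m → r * (1 + 2 * (b + m)) ≡ 2 * (r * b) + (1 + 2 * m) * r
    distribute = solve-∀
    factor : ∀ m r → 2 * (m * (2 + 2 * m)) + (m + 2 * m) * r ≡ (4 + 4 * m + 3 * r) * m
    factor = solve-∀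
    expand-left : ∀ p q → 4 + 4 * (2 + p) + 3 * (3 + q) ≡ 4 * p + (21 + 3 * q)
    expand-left = solve-∀
    expand-right : ∀ p → 4 * p + (8 + 4 * p) ≡ 8 * (1 + p)
    expand-right = solve-∀
    excess : ∀ q → 21 + 3 * q + (87 + 33 * q) ≡ 8 + 4 * (25 + 9 * q)
    excess = solve-∀
    main-term : 4 + 4 * m + 3 * (3 + q) ≤ 8 * (1 + p)
    main-term = begin
      4 + 4 * m + 3 * (3 + q)       ≡⟨ expand-left p q ⟩
      4 * p + (21 + 3 * q)          ≤⟨ +-monoʳ-≤ (4 * p) (m≤m+n (21 + 3 * q) (87 + 33 * q)) ⟩
      4 * p + (21 + 3 * q + (87 + 33 * q)) ≡⟨ cong (4 * p +_) (excess q) ⟩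
      4 * p + (8 + 4 * (25 + 9 * q)) ≤⟨ +-monoʳ-≤ (4 * p) (+-monoʳ-≤ 8 (*-monoʳ-≤ 4 large)) ⟩
      4 * p + (8 + 4 * p)           ≡⟨ expand-right p ⟩
      8 * (1 + p)                   ∎

-- Position of the candidate values among the covered intervals.

module _ (k m f₁ g₀ : ℕ) where

  private
    r  = suc k
    f₀ = f₁ + suc m

  -- When `f₀ ≤ g₀`, this says that the interval from `x C r` to `x C r + m` meets the one from `f₀`
  -- to `g₀`, where `g₀` stands for the complementary value `N ∸ f₀`. Building `f₀` from `f₁` avoids
  -- truncated subtraction.
  NearHalf : ℕ → Set
  NearHalf x = f₀ ≤ x C r + m × x C r ≤ g₀

  near-half? : Dec (∃[ x ] (x < suc m × NearHalf x))
  near-half? = anyUpTo? (λ x → (f₀ ≤? x C r + m) ×-dec (x C r ≤? g₀)) (suc m)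

  uncovered-f₀ : f₀ ≤ g₀ → ¬ (∃[ x ] (x < suc m × NearHalf x)) → ¬ Covered r m f₀
  uncovered-f₀ f₀≤g₀ none (x , s , x≤m , s≤m , f₀≡) = none
    (x , s≤s x≤m , ≤-trans (≤-reflexive f₀≡) (+-monoʳ-≤ (x C r) s≤m) ,
     ≤-trans (m≤m+n _ s) (≤-trans (≤-reflexive (sym f₀≡)) f₀≤g₀))

  uncovered-g₀ : f₀ ≤ g₀ → ¬ (∃[ x ] (x < suc m × NearHalf x)) → ¬ Covered r m g₀
  uncovered-g₀ f₀≤g₀ none (x , s , x≤m , s≤m , g₀≡) = none
    (x , s≤s x≤m , ≤-trans f₀≤g₀ (≤-trans (≤-reflexive g₀≡) (+-monoʳ-≤ (x C r) s≤m)) ,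
     ≤-trans (m≤m+n _ s) (≤-reflexive (sym g₀≡)))

  module _ (g₀≤1+f₀ : g₀ ≤ suc f₀) (x : ℕ) (gap : 2 + 2 * m < x C k) (near : NearHalf (suc x)) where

    open ≤-Reasoning

    -- Intervals from `suc x` on start at `f₀ ∸ m` or later, beyond `f₁`. Those up to `x` end before
    -- `f₁`, since `suc x C r ≤ f₁ + m + 2` and the gap below it exceeds `2 + 2 * m`.
    uncovered-f₁ : ¬ Covered r m f₁
    uncovered-f₁ (y , s , y≤m , s≤m , f₁≡) with suc x ≤? y
    ... | yes x<y = <⇒≱ f₁+m<f₀ (begin
      f₀               ≤⟨ proj₁ near ⟩
      suc x C r + m    ≤⟨ +-monoˡ-≤ m (C-monoˡ-≤ r x<y) ⟩
      y C r + m        ≤⟨ +-monoˡ-≤ m (≤-trans (m≤m+n _ s) (≤-reflexive (sym f₁≡))) ⟩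
      f₁ + m           ∎)
      where
      f₁+m<f₀ : f₁ + m < f₀
      f₁+m<f₀ = ≤-reflexive (sym (+-suc f₁ m))
    ... | no  x≮y = <⇒≱ gap (+-cancelʳ-≤ (x C r) _ _ (begin
      x C k + x C r               ≡⟨ pascal x k ⟨
      suc x C r                   ≤⟨ ≤-trans (proj₂ near) g₀≤1+f₀ ⟩
      suc (f₁ + suc m)            ≡⟨ cong (λ u → suc (u + suc m)) f₁≡ ⟩
      suc (y C r + s + suc m)     ≤⟨ s≤s (+-monoˡ-≤ (suc m) (+-mono-≤ (C-monoˡ-≤ r (s≤s⁻¹ (≰⇒> x≮y))) s≤m)) ⟩
      suc (x C r + m + suc m)     ≡⟨ regroup (x C r) m ⟩
      2 + 2 * m + x C r           ∎))
      where
      regroup : ∀ b m → suc (b + m + suc m) ≡ 2 + 2 * m + b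
      regroup = solve-∀

    -- The mirror image: intervals up to `suc x` end by `g₀ + m`, and the gap above `suc x C r`, at
    -- least as wide as the one below, pushes the later ones past `g₀ + m + 1`.
    uncovered-g₁ : ¬ Covered r m (g₀ + suc m)
    uncovered-g₁ (y , s , y≤m , s≤m , g₁≡) with y ≤? suc x
    ... | yes y≤x = <⇒≱ (+-monoʳ-< g₀ (n<1+n m)) (begin
      g₀ + suc m       ≡⟨ g₁≡ ⟩
      y C r + s        ≤⟨ +-mono-≤ (≤-trans (C-monoˡ-≤ r y≤x) (proj₂ near)) s≤m ⟩
      g₀ + m           ∎)
    ... | no  y≰x = <⇒≱ (<-≤-trans gap (C-monoˡ-suc x k)) (+-cancelʳ-≤ (suc x C r) _ _ (begin
      suc x C k + suc x C r        ≡⟨ pascal (suc x) k ⟨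
      suc (suc x) C r              ≤⟨ C-monoˡ-≤ r (≰⇒> y≰x) ⟩
      y C r                        ≤⟨ m≤m+n _ s ⟩
      y C r + s                    ≡⟨ g₁≡ ⟨
      g₀ + suc m                   ≤⟨ +-monoˡ-≤ (suc m) (≤-trans g₀≤1+f₀ (s≤s (proj₁ near))) ⟩
      suc (suc x C r + m) + suc m  ≡⟨ regroup (suc x C r) m ⟩
      2 + 2 * m + suc x C r        ∎))
      where
      regroup : ∀ b m → suc (b + m) + suc m ≡ 2 + 2 * m + b
      regroup = solve-∀

-- The dichotomy between the two pairs.

half-bounds : ∀ N → (N / 2 ≤ N ∸ N / 2) × (N ∸ N / 2 ≤ suc (N / 2))
half-bounds N = m+n≤o⇒m≤o∸n h (begin
    h + h          ≤⟨ m≤n+m (h + h) (N % 2) ⟩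
    N % 2 + (h + h) ≡⟨ N≡ ⟨
    N              ∎) ,
  m≤n+o⇒m∸n≤o N h (begin
    N               ≡⟨ N≡ ⟩
    N % 2 + (h + h) ≤⟨ +-monoˡ-≤ (h + h) (s≤s⁻¹ (m%n<n N 2)) ⟩
    suc (h + h)     ≡⟨ +-suc h h ⟨
    h + suc h       ∎)
  where
  open ≤-Reasoning
  h = N / 2
  double : ∀ h → h * 2 ≡ h + h
  double = solve-∀
  N≡ : N ≡ N % 2 + (h + h)
  N≡ = trans (m≡m%n+[m/n]*n N 2) (cong (N % 2 +_) (double h))

avoidable-pair : ∀ q p → 25 + 9 * q ≤ p → let m = 2 + p ; N = m C (3 + q) in
  AbsolutelyAvoidable (3 + q) m (N / 2) ⊎ AbsolutelyAvoidable (3 + q) m (N / 2 ∸ m ∸ 1)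
avoidable-pair q p large = split (near-half? (2 + q) m f₁ g₀)
  where
  open ≤-Reasoning
  m = 2 + p
  r = 3 + q
  N = m C r
  f₀ = N / 2
  g₀ = N ∸ f₀
  f₁ = f₀ ∸ m ∸ 1
  r≤m : r ≤ m
  r≤m = s≤s (s≤s (≤-trans (+-mono-≤ (s≤s (z≤n {24})) (m≤n*m q 9)) large))
  m<f₀ : suc m ≤ f₀
  m<f₀ = begin
    suc m           ≡⟨ m*n/n≡m (suc m) 2 ⟨
    suc m * 2 / 2   ≤⟨ /-monoˡ-≤ 2 (≤-trans (≤-trans (*-monoʳ-≤ (suc m) (s≤s (s≤s (z≤n {2})))) (≤-reflexive (*-comm (suc m) 4))) (4[m+1]≤N q p large)) ⟩
    f₀              ∎
  f₁+1+m : f₁ + suc m ≡ f₀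
  f₁+1+m = trans (cong (_+ suc m) (trans (∸-+-assoc f₀ m 1) (cong (f₀ ∸_) (+-comm m 1)))) (m∸n+n≡m m<f₀)
  f₀≤N : f₀ ≤ N
  f₀≤N = m/n≤m N 2
  f₁≤f₀ : f₁ ≤ f₀
  f₁≤f₀ = ≤-trans (m∸n≤m (f₀ ∸ m) 1) (m∸n≤m f₀ m)
  f₀≤g₀ : f₁ + suc m ≤ g₀
  f₀≤g₀ = ≤-trans (≤-reflexive f₁+1+m) (proj₁ (half-bounds N))
  g₀≤1+f₀ : g₀ ≤ suc (f₁ + suc m)
  g₀≤1+f₀ = ≤-trans (proj₂ (half-bounds N)) (s≤s (≤-reflexive (sym f₁+1+m)))
  g₁ : g₀ + suc m ≡ N ∸ f₁
  g₁ = sym (begin-equality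
    N ∸ f₁                     ≡⟨ cong (_∸ f₁) (m+[n∸m]≡n f₀≤N) ⟨
    f₀ + g₀ ∸ f₁               ≡⟨ cong (λ u → u + g₀ ∸ f₁) f₁+1+m ⟨
    f₁ + suc m + g₀ ∸ f₁       ≡⟨ cong (_∸ f₁) (+-assoc f₁ (suc m) g₀) ⟩
    f₁ + (suc m + g₀) ∸ f₁     ≡⟨ m+n∸m≡n f₁ (suc m + g₀) ⟩
    suc m + g₀                 ≡⟨ +-comm (suc m) g₀ ⟩
    g₀ + suc m                 ∎)
  witnesses = clique-plus-sparse (2 + q) m r≤m
  avoidable : ∀ f → f ≤ N → ¬ Covered r m f → ¬ Covered r m (N ∸ f) → AbsolutelyAvoidable r m f
  avoidable f f≤N = uncovered⇒avoidable r m f (s≤s z≤n) f≤N witnesses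
  split : Dec (∃[ x ] (x < suc m × NearHalf (2 + q) m f₁ g₀ x)) →
    AbsolutelyAvoidable r m f₀ ⊎ AbsolutelyAvoidable r m f₁
  split (no none) = inj₁ (avoidable f₀ f₀≤N
    (subst (λ u → ¬ Covered r m u) f₁+1+m (uncovered-f₀ (2 + q) m f₁ g₀ f₀≤g₀ none))
    (uncovered-g₀ (2 + q) m f₁ g₀ f₀≤g₀ none))
  -- As `0 C r` is zero, `x = 0` near the half would force `f₀ ≤ m`.
  split (yes (zero , _ , f₀≤m , _)) = contradiction (≤-trans m<f₀ (≤-trans (≤-reflexive (sym f₁+1+m)) f₀≤m)) (<-irrefl refl)
  split (yes (suc x , x<m , near)) = inj₂ (avoidable f₁ (≤-trans f₁≤f₀ f₀≤N)
    (uncovered-f₁ (2 + q) m f₁ g₀ g₀≤1+f₀ x gap near)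
    (subst (λ u → ¬ Covered r m u) g₁ (uncovered-g₁ (2 + q) m f₁ g₀ g₀≤1+f₀ x gap near)))
    where
    N≤ : N ≤ 1 + 2 * (suc x C r + m)
    N≤ = begin
      N                           ≡⟨ m+[n∸m]≡n f₀≤N ⟨
      f₀ + g₀                     ≤⟨ +-monoʳ-≤ f₀ (proj₂ (half-bounds N)) ⟩
      f₀ + suc f₀                 ≡⟨ +-suc f₀ f₀ ⟩
      suc (f₀ + f₀)               ≤⟨ s≤s (+-mono-≤ f₀≤ (≤-trans f₀≤ (m≤m+n _ 0))) ⟩
      1 + 2 * (suc x C r + m)     ∎
      where
      f₀≤ : f₀ ≤ suc x C r + m
      f₀≤ = ≤-trans (≤-reflexive (sym f₁+1+m)) (proj₁ near)
    gap : 2 + 2 * m < x C (2 + q)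
    gap = binomial-gap q p large x (s≤s⁻¹ x<m) N≤

theorem1p3 : (r : ℕ) → 3 ≤ r →
    ∃[ m₀ ] (∀ m → m₀ ≤ m →
    AbsolutelyAvoidable r m ((m C r) / 2)
    ⊎ AbsolutelyAvoidable r m ((m C r) / 2 ∸ m ∸ 1))
theorem1p3 (suc (suc (suc q))) (s≤s (s≤s (s≤s z≤n))) = 27 + 9 * q , conclude
  where
  -- Since `m = 2 + p`, the threshold on `p` is raised by two.
  conclude : ∀ m → 27 + 9 * q ≤ m →
    AbsolutelyAvoidable (3 + q) m ((m C (3 + q)) / 2) ⊎ AbsolutelyAvoidable (3 + q) m ((m C (3 + q)) / 2 ∸ m ∸ 1)
  conclude (suc (suc p)) (s≤s (s≤s large)) = avoidable-pair q p large
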